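{- Let $G$ be a graph with $n$ vertices, $m$ edges, minimum degree $\delta$ and maximum degree $\Delta$. Then \[1 \leq \alpha_{ir}(G) \leq \min \left\{ \Delta - \delta +1, \, \left \lfloor \frac{n-\delta+1}{2} \right \rfloor , \, \frac{1+ \sqrt{2n^2-2n-4m+1}}{2} \right\}.\] Moreover, the bound is sharp: there exist graphs for which the lower bound holds with equality, and there exist graphs for which the upper bound holds with equality.
   Context: All graphs are finite, simple, undirected and have at least one vertex. An irregular independent set of a graph $G$ is an independent set $A$ of $G$ such that any two distinct vertices in $A$ have different degrees in $G$. The irregular independence number $\alpha_{ir}(G)$ is the size of a largest irregular independent set of $G$. -}

module Defs where

open import Data.Fin.Base using (Fin)
import Data.Fin.Properties as Fin
open import Data.Fin.Subset using (Subset; inside; outside; _∈_; ∣_∣) renaming (⊥ to ∅)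
open import Data.Fin.Subset.Properties using (_∈?_; ∉⊥; ∣⊥∣≡0)
open import Data.Integer.Base as ℤ using (ℤ; +_)
open import Data.List.Base
  using (List; []; _∷_; _++_; map; filter; length; allFin; cartesianProduct)
open import Data.List.Extrema.Nat using (min; max; v≤max⁺; argmax-sel)
open import Data.List.Membership.Propositional using () renaming (_∈_ to _∈ˡ_)
open import Data.List.Membership.Propositional.Properties
  using (∈-map⁺; ∈-map⁻; ∈-++⁺ˡ; ∈-++⁺ʳ; ∈-filter⁺; ∈-filter⁻)
open import Data.List.Relation.Unary.Any as Any using (here)
open import Data.Nat.Base as ℕ using (ℕ; zero; suc)
import Data.Nat.Properties as ℕ
open import Data.Product.Base using (∃; ∃-syntax; _×_; _,_; proj₁; proj₂)
open import Data.Rational.Base as ℚ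
  using (ℚ; 0ℚ; 1ℚ; ½; _+_; _*_; _-_; -_; 1/_; _<_; _≤_; positive; nonNegative)
open import Data.Rational.Properties
open import Data.Rational.Solver using (module +-*-Solver)
open import Data.Sum.Base using (_⊎_; inj₁; inj₂)
open import Data.Vec.Base using (tabulate; []; _∷_)
open import Function.Base using (id)
open import Level using (0ℓ)
open import Relation.Binary.Core using (Rel)
open import Relation.Binary.Definitions using (Decidable; Symmetric; Irreflexive; tri<; tri≈; tri>)
open import Relation.Binary.PropositionalEquality
open import Relation.Nullary using (Dec; yes; no; ¬_; does; contradiction)
open import Relation.Nullary.Decidable using (_×-dec_; _→-dec_; ¬?)

------------------------------------------------------------------------
-- Graphs

record Graph : Set₁ where
  field
    order         : ℕ
    .⦃ nonEmpty ⦄ : ℕ.NonZero order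

  Vertex : Set
  Vertex = Fin order

  infix 4 _~_ _~?_
  field
    _~_      : Rel Vertex 0ℓ
    _~?_     : Decidable _~_
    ~-sym    : Symmetric _~_
    ~-irrefl : Irreflexive _≡_ _~_

module _ (G : Graph) where
  open Graph G

  neighbours : Vertex → Subset order
  neighbours u = tabulate (λ v → does (u ~? v))

  degree : Vertex → ℕ
  degree u = ∣ neighbours u ∣

  -- Each edge is listed once, with its smaller endpoint first.
  edges : List (Vertex × Vertex)
  edges = filter (λ (u , v) → (u Fin.<? v) ×-dec (u ~? v))
                 (cartesianProduct (allFin order) (allFin order))

  size : ℕ
  size = length edges

  -- `min` and `max` take a default value; every degree lies between 0 and
  -- `order` and there is at least one vertex, so the defaults never matter.
  minDegree maxDegree : ℕ
  minDegree = min order (map degree (allFin order))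
  maxDegree = max 0 (map degree (allFin order))

  Independent : Subset order → Set
  Independent A = ∀ u → u ∈ A → ∀ v → v ∈ A → ¬ (u ~ v)

  Irregular : Subset order → Set
  Irregular A = ∀ u → u ∈ A → ∀ v → v ∈ A → ¬ (u ≡ v) → ¬ (degree u ≡ degree v)

  IrregularIndependent : Subset order → Set
  IrregularIndependent A = Independent A × Irregular A

  irregularIndependent? : ∀ A → Dec (IrregularIndependent A)
  irregularIndependent? A =
    Fin.all? (λ u → (u ∈? A) →-dec Fin.all? (λ v → (v ∈? A) →-dec ¬? (u ~? v)))
    ×-dec
    Fin.all? (λ u → (u ∈? A) →-dec Fin.all? (λ v → (v ∈? A) →-dec
      (¬? (u Fin.≟ v) →-dec ¬? (degree u ℕ.≟ degree v))))

allSubsets : ∀ n → List (Subset n)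
allSubsets zero    = [] ∷ []
allSubsets (suc n) = map (outside ∷_) (allSubsets n) ++ map (inside ∷_) (allSubsets n)

-- The default 0 is harmless because the empty set is irregular independent.
α-ir : Graph → ℕ
α-ir G = max 0 (map ∣_∣ (filter (irregularIndependent? G) (allSubsets (Graph.order G))))

∈-allSubsets : ∀ {n} (A : Subset n) → A ∈ˡ allSubsets n
∈-allSubsets []            = here refl
∈-allSubsets (outside ∷ A) = ∈-++⁺ˡ (∈-map⁺ (outside ∷_) (∈-allSubsets A))
∈-allSubsets (inside  ∷ A) = ∈-++⁺ʳ (map (outside ∷_) (allSubsets _)) (∈-map⁺ (inside ∷_) (∈-allSubsets A))

α-ir-upper : ∀ G A → IrregularIndependent G A → ∣ A ∣ ℕ.≤ α-ir G
α-ir-upper G A irr = v≤max⁺ 0 _ (inj₂ (Any.map ℕ.≤-reflexive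
  (∈-map⁺ ∣_∣ (∈-filter⁺ (irregularIndependent? G) (∈-allSubsets A) irr))))

α-ir-attained : ∀ G → ∃[ A ] IrregularIndependent G A × ∣ A ∣ ≡ α-ir G
α-ir-attained G with argmax-sel id 0 (map ∣_∣ (filter (irregularIndependent? G) (allSubsets (Graph.order G))))
... | inj₁ α≡0 = ∅ , ((λ _ u∈∅ → contradiction u∈∅ ∉⊥) , (λ _ u∈∅ → contradiction u∈∅ ∉⊥))
               , trans (∣⊥∣≡0 (Graph.order G)) (sym α≡0)
... | inj₂ α∈ with ∈-map⁻ ∣_∣ α∈
...   | A , A∈ , α≡ = A , proj₂ (∈-filter⁻ (irregularIndependent? G) {xs = allSubsets (Graph.order G)} A∈)
                        , sym α≡

------------------------------------------------------------------------
-- Real numbers as two-sided Dedekind cuts of ℚ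

record ℝ : Set₁ where
  field
    Lower Upper     : ℚ → Set
    lower-inhabited : ∃ Lower
    upper-inhabited : ∃ Upper
    lower-closed    : ∀ {q r} → q < r → Lower r → Lower q
    upper-closed    : ∀ {q r} → q < r → Upper q → Upper r
    lower-open      : ∀ {q} → Lower q → ∃[ r ] q < r × Lower r
    upper-open      : ∀ {r} → Upper r → ∃[ q ] q < r × Upper q
    disjoint        : ∀ {q} → Lower q → ¬ Upper q
    located         : ∀ {q r} → q < r → Lower q ⊎ Upper r

open ℝ

infix 4 _≤ᴿ_ _≃ᴿ_
_≤ᴿ_ _≃ᴿ_ : ℝ → ℝ → Set
x ≤ᴿ y = ∀ q → Lower x q → Lower y q
x ≃ᴿ y = x ≤ᴿ y × y ≤ᴿ x

private
  p<p+1 : ∀ p → p < p + 1ℚ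
  p<p+1 p = subst (_< p + 1ℚ) (+-identityʳ p) (+-monoʳ-< p (positive⁻¹ 1ℚ))

  p-1<p : ∀ p → p - 1ℚ < p
  p-1<p p = subst (p - 1ℚ <_) (+-identityʳ p) (+-monoʳ-< p (negative⁻¹ (- 1ℚ)))

fromℚ : ℚ → ℝ
fromℚ p .Lower q = q < p
fromℚ p .Upper q = p < q
fromℚ p .lower-inhabited = p - 1ℚ , p-1<p p
fromℚ p .upper-inhabited = p + 1ℚ , p<p+1 p
fromℚ p .lower-closed = <-trans
fromℚ p .upper-closed q<r p<q = <-trans p<q q<r
fromℚ p .lower-open = <-dense
fromℚ p .upper-open p<r = let q , p<q , q<r = <-dense p<r in q , q<r , p<q
fromℚ p .disjoint = <-asym
fromℚ p .located {q} q<r with q <? p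
... | yes q<p = inj₁ q<p
... | no  q≮p = inj₂ (≤-<-trans (≮⇒≥ q≮p) q<r)

ℤ→ℚ : ℤ → ℚ
ℤ→ℚ z = z ℚ./ 1

fromℕ : ℕ → ℝ
fromℕ n = fromℚ (ℤ→ℚ (+ n))

private
  lower-common : ∀ x y {a b} → Lower x a → Lower y b →
                 ∃[ c ] (∀ q → q < a → q < b → q < c) × Lower x c × Lower y c
  lower-common x y {a} {b} xa yb with <-cmp a b
  ... | tri< a<b _ _  = a , (λ _ q<a _ → q<a) , xa , lower-closed y a<b yb
  ... | tri≈ _ refl _ = a , (λ _ q<a _ → q<a) , xa , yb
  ... | tri> _ _ b<a  = b , (λ _ _ q<b → q<b) , lower-closed x b<a xa , yb

infixl 5 _⊓ᴿ_
_⊓ᴿ_ : ℝ → ℝ → ℝ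
(x ⊓ᴿ y) .Lower q = Lower x q × Lower y q
(x ⊓ᴿ y) .Upper q = Upper x q ⊎ Upper y q
(x ⊓ᴿ y) .lower-inhabited =
  let a , xa     = lower-inhabited x
      b , yb     = lower-inhabited y
      c , _ , lc = lower-common x y xa yb
  in  c , lc
(x ⊓ᴿ y) .upper-inhabited = let a , xa = upper-inhabited x in a , inj₁ xa
(x ⊓ᴿ y) .lower-closed q<r (xr , yr) = lower-closed x q<r xr , lower-closed y q<r yr
(x ⊓ᴿ y) .upper-closed q<r (inj₁ xq) = inj₁ (upper-closed x q<r xq)
(x ⊓ᴿ y) .upper-closed q<r (inj₂ yq) = inj₂ (upper-closed y q<r yq)
(x ⊓ᴿ y) .lower-open {q} (xq , yq) =
  let a , q<a , xa   = lower-open x xq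
      b , q<b , yb   = lower-open y yq
      c , below , lc = lower-common x y xa yb
  in  c , below q q<a q<b , lc
(x ⊓ᴿ y) .upper-open (inj₁ xr) = let q , q<r , xq = upper-open x xr in q , q<r , inj₁ xq
(x ⊓ᴿ y) .upper-open (inj₂ yr) = let q , q<r , yq = upper-open y yr in q , q<r , inj₂ yq
(x ⊓ᴿ y) .disjoint (xq , _) (inj₁ xq′) = disjoint x xq xq′
(x ⊓ᴿ y) .disjoint (_ , yq) (inj₂ yq′) = disjoint y yq yq′
(x ⊓ᴿ y) .located q<r with located x q<r | located y q<r
... | inj₂ xr | _       = inj₂ (inj₁ xr)
... | inj₁ _  | inj₂ yr = inj₂ (inj₂ yr)
... | inj₁ xq | inj₁ yq = inj₁ (xq , yq)

private
  [a+p]-p : ∀ a p → (a + p) - p ≡ a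
  [a+p]-p = solve 2 (λ a p → (a :+ p) :- p := a) refl where open +-*-Solver

  q-p<a⇒q<a+p : ∀ {a q} p → q - p < a → q < a + p
  q-p<a⇒q<a+p {a} {q} p lt = subst (_< a + p) (lem q p) (+-monoˡ-< p lt)
    where
    open +-*-Solver
    lem : ∀ q p → (q - p) + p ≡ q
    lem = solve 2 (λ q p → (q :- p) :+ p := q) refl

  a<q-p⇒a+p<q : ∀ {a q} p → a < q - p → a + p < q
  a<q-p⇒a+p<q {a} {q} p lt = subst (a + p <_) (lem q p) (+-monoˡ-< p lt)
    where
    open +-*-Solver
    lem : ∀ q p → (q - p) + p ≡ q
    lem = solve 2 (λ q p → (q :- p) :+ p := q) refl

infixr 6 _+ᴿ_
_+ᴿ_ : ℚ → ℝ → ℝ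
(p +ᴿ x) .Lower q = Lower x (q - p)
(p +ᴿ x) .Upper q = Upper x (q - p)
(p +ᴿ x) .lower-inhabited =
  let a , xa = lower-inhabited x in a + p , subst (Lower x) (sym ([a+p]-p a p)) xa
(p +ᴿ x) .upper-inhabited =
  let a , xa = upper-inhabited x in a + p , subst (Upper x) (sym ([a+p]-p a p)) xa
(p +ᴿ x) .lower-closed q<r = lower-closed x (+-monoˡ-< (- p) q<r)
(p +ᴿ x) .upper-closed q<r = upper-closed x (+-monoˡ-< (- p) q<r)
(p +ᴿ x) .lower-open xq =
  let a , lt , xa = lower-open x xq
  in  a + p , q-p<a⇒q<a+p p lt , subst (Lower x) (sym ([a+p]-p a p)) xa
(p +ᴿ x) .upper-open xr =
  let a , lt , xa = upper-open x xr
  in  a + p , a<q-p⇒a+p<q p lt , subst (Upper x) (sym ([a+p]-p a p)) xa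
(p +ᴿ x) .disjoint = disjoint x
(p +ᴿ x) .located q<r = located x (+-monoˡ-< (- p) q<r)

private
  double-half : ∀ a → ½ * a + ½ * a ≡ a
  double-half a = trans (sym (*-distribʳ-+ a ½ ½)) (*-identityˡ a)

  half-double : ∀ a → ½ * (a + a) ≡ a
  half-double a = trans (*-distribˡ-+ ½ a a) (double-half a)

infixl 8 _/2
_/2 : ℝ → ℝ
(x /2) .Lower q = Lower x (q + q)
(x /2) .Upper q = Upper x (q + q)
(x /2) .lower-inhabited =
  let a , xa = lower-inhabited x in ½ * a , subst (Lower x) (sym (double-half a)) xa
(x /2) .upper-inhabited =
  let a , xa = upper-inhabited x in ½ * a , subst (Upper x) (sym (double-half a)) xa
(x /2) .lower-closed q<r = lower-closed x (+-mono-< q<r q<r)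
(x /2) .upper-closed q<r = upper-closed x (+-mono-< q<r q<r)
(x /2) .lower-open {q} xq =
  let a , lt , xa = lower-open x xq
  in  ½ * a , subst (_< ½ * a) (half-double q) (*-monoʳ-<-pos ½ lt)
    , subst (Lower x) (sym (double-half a)) xa
(x /2) .upper-open {r} xr =
  let a , lt , xa = upper-open x xr
  in  ½ * a , subst (½ * a <_) (half-double r) (*-monoʳ-<-pos ½ lt)
    , subst (Upper x) (sym (double-half a)) xa
(x /2) .disjoint = disjoint x
(x /2) .located q<r = located x (+-mono-< q<r q<r)

private
  square-mono-< : ∀ {q r} → 0ℚ ≤ q → q < r → q * q < r * r
  square-mono-< {q} {r} 0≤q q<r =
    ≤-<-trans (*-monoˡ-≤-nonNeg q ⦃ nonNegative 0≤q ⦄ (<⇒≤ q<r))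
              (*-monoˡ-<-pos r ⦃ positive (≤-<-trans 0≤q q<r) ⦄ q<r)

  quotient : ∀ a w → 0ℚ < w → ∃[ e ] e * w ≡ a
  quotient a w 0<w = a * 1/ w , trans (*-assoc a (1/ w) w)
                                      (trans (cong (a *_) (*-inverseˡ w)) (*-identityʳ a))
    where instance _ = ℚ.>-nonZero 0<w

  0<-difference : ∀ {a b} → a < b → 0ℚ < b - a
  0<-difference {a} {b} a<b = subst (_< b - a) (+-inverseʳ a) (+-monoˡ-< (- a) a<b)

  square-lower-open : ∀ {q d} → 0ℚ ≤ q → q * q < d → ∃[ r ] q < r × r * r < d
  square-lower-open {q} {d} 0≤q q²<d = q + e , q<r , r²<d
    where
    η = d - q * q
    0<η : 0ℚ < η
    0<η = 0<-difference q²<d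
    w = (q + q) + (1ℚ + η)
    1+η≤w : 1ℚ + η ≤ w
    1+η≤w = subst (_≤ w) (+-identityˡ _) (+-monoˡ-≤ (1ℚ + η) (+-mono-≤ 0≤q 0≤q))
    η<1+η : η < 1ℚ + η
    η<1+η = subst (_< 1ℚ + η) (+-identityˡ η) (+-monoˡ-< η (positive⁻¹ 1ℚ))
    1<1+η : 1ℚ < 1ℚ + η
    1<1+η = +-monoʳ-< 1ℚ 0<η
    1<w : 1ℚ < w
    1<w = <-≤-trans 1<1+η 1+η≤w
    0<w : 0ℚ < w
    0<w = <-trans (positive⁻¹ 1ℚ) 1<w
    e = proj₁ (quotient η w 0<w)
    ew≡η : e * w ≡ η
    ew≡η = proj₂ (quotient η w 0<w)
    0<e : 0ℚ < e
    0<e = *-cancelʳ-<-nonNeg w ⦃ nonNegative (<⇒≤ 0<w) ⦄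
            (subst₂ _<_ (sym (*-zeroˡ w)) (sym ew≡η) 0<η)
    e<1+η : e < 1ℚ + η
    e<1+η = *-cancelʳ-<-nonNeg w ⦃ nonNegative (<⇒≤ 0<w) ⦄
      (subst (_< (1ℚ + η) * w) (sym ew≡η)
        (<-trans η<1+η (subst (_< (1ℚ + η) * w) (*-identityʳ (1ℚ + η))
          (*-monoʳ-<-pos (1ℚ + η) ⦃ positive (<-trans 0<η η<1+η) ⦄ 1<w))))
    q<r : q < q + e
    q<r = subst (_< q + e) (+-identityʳ q) (+-monoʳ-< q 0<e)
    excess : e * ((q + q) + e) < η
    excess = subst (e * ((q + q) + e) <_) ew≡η
               (*-monoʳ-<-pos e ⦃ positive 0<e ⦄ (+-monoʳ-< (q + q) e<1+η))
    r²<d : (q + e) * (q + e) < d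
    r²<d = subst₂ _<_
      (solve 2 (λ q e → q :* q :+ e :* ((q :+ q) :+ e) := (q :+ e) :* (q :+ e)) refl q e)
      (solve 2 (λ s d → s :+ (d :- s) := d) refl (q * q) d)
      (+-monoʳ-< (q * q) excess)
      where open +-*-Solver

  square-upper-open : ∀ {r d} → 0ℚ < r → 0ℚ ≤ d → d < r * r →
                      ∃[ q ] q < r × 0ℚ < q × d < q * q
  square-upper-open {r} {d} 0<r 0≤d d<r² = r - e , q<r , 0<-difference e<r , d<q²
    where
    w = r + r
    r<w : r < w
    r<w = subst (_< w) (+-identityʳ r) (+-monoʳ-< r 0<r)
    0<w : 0ℚ < w
    0<w = <-trans 0<r r<w
    η = r * r - d
    e = proj₁ (quotient η w 0<w)
    ew≡η : e * w ≡ η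
    ew≡η = proj₂ (quotient η w 0<w)
    0<e : 0ℚ < e
    0<e = *-cancelʳ-<-nonNeg w ⦃ nonNegative (<⇒≤ 0<w) ⦄
            (subst₂ _<_ (sym (*-zeroˡ w)) (sym ew≡η) (0<-difference d<r²))
    η≤r² : η ≤ r * r
    η≤r² = subst (η ≤_) (+-identityʳ (r * r)) (+-monoʳ-≤ (r * r) (neg-antimono-≤ 0≤d))
    e<r : e < r
    e<r = *-cancelʳ-<-nonNeg w ⦃ nonNegative (<⇒≤ 0<w) ⦄
      (subst (_< r * w) (sym ew≡η) (≤-<-trans η≤r² (*-monoʳ-<-pos r ⦃ positive 0<r ⦄ r<w)))
    q<r : r - e < r
    q<r = subst (r - e <_) (+-identityʳ r) (+-monoʳ-< r (neg-antimono-< 0<e))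
    0<e² : 0ℚ < e * e
    0<e² = subst (_< e * e) (*-zeroʳ e) (*-monoʳ-<-pos e ⦃ positive 0<e ⦄ 0<e)
    q²≡d+e² : (r - e) * (r - e) ≡ d + e * e
    q²≡d+e² = begin
      (r - e) * (r - e)
        ≡⟨ solve 2 (λ r e → (r :- e) :* (r :- e) := (r :* r :- e :* (r :+ r)) :+ e :* e) refl r e ⟩
      (r * r - e * w) + e * e
        ≡⟨ cong (λ z → (r * r - z) + e * e) ew≡η ⟩
      (r * r - (r * r - d)) + e * e
        ≡⟨ solve 3 (λ s d t → (s :- (s :- d)) :+ t := d :+ t) refl (r * r) d (e * e) ⟩
      d + e * e ∎
      where
      open ≡-Reasoning
      open +-*-Solver
    d<q² : d < (r - e) * (r - e)
    d<q² = subst₂ _<_ (+-identityʳ d) (sym q²≡d+e²) (+-monoʳ-< d 0<e²)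

-- For negative d this cut is 0; the radicand below is always at least 1.
√ : ℚ → ℝ
√ d .Lower q = q < 0ℚ ⊎ q * q < d
√ d .Upper q = 0ℚ < q × d < q * q
√ d .lower-inhabited = - 1ℚ , inj₁ (negative⁻¹ (- 1ℚ))
√ d .upper-inhabited with d <? 1ℚ
... | yes d<1 = 1ℚ , positive⁻¹ 1ℚ , d<1
... | no  d≮1 = d + 1ℚ , 0<s , <-≤-trans (p<p+1 d)
      (subst (_≤ (d + 1ℚ) * (d + 1ℚ)) (*-identityʳ (d + 1ℚ))
        (*-monoˡ-≤-nonNeg (d + 1ℚ) ⦃ nonNegative (<⇒≤ 0<s) ⦄ (≤-trans 1≤d (<⇒≤ (p<p+1 d)))))
  where
  1≤d = ≮⇒≥ d≮1
  0<s : 0ℚ < d + 1ℚ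
  0<s = <-trans (<-≤-trans (positive⁻¹ 1ℚ) 1≤d) (p<p+1 d)
√ d .lower-closed {q} q<r l with q <? 0ℚ
... | yes q<0 = inj₁ q<0
√ d .lower-closed {q} q<r (inj₁ r<0)  | no q≮0 = contradiction (<-trans q<r r<0) q≮0
√ d .lower-closed {q} q<r (inj₂ r²<d) | no q≮0 = inj₂ (<-trans (square-mono-< (≮⇒≥ q≮0) q<r) r²<d)
√ d .upper-closed q<r (0<q , d<q²) =
  <-trans 0<q q<r , <-trans d<q² (square-mono-< (<⇒≤ 0<q) q<r)
√ d .lower-open {q} l with q <? 0ℚ
... | yes q<0 = let r , q<r , r<0 = <-dense q<0 in r , q<r , inj₁ r<0
√ d .lower-open {q} (inj₁ q<0)  | no q≮0 = contradiction q<0 q≮0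
√ d .lower-open {q} (inj₂ q²<d) | no q≮0 =
  let r , q<r , r²<d = square-lower-open (≮⇒≥ q≮0) q²<d in r , q<r , inj₂ r²<d
√ d .upper-open {r} (0<r , d<r²) with d <? 0ℚ
... | no  d≮0 = square-upper-open 0<r (≮⇒≥ d≮0) d<r²
... | yes d<0 =
  let q , 0<q , q<r = <-dense 0<r
  in  q , q<r , 0<q , <-trans d<0 (square-mono-< ≤-refl 0<q)
√ d .disjoint (inj₁ q<0)  (0<q , _)  = <-asym q<0 0<q
√ d .disjoint (inj₂ q²<d) (_ , d<q²) = <-asym q²<d d<q²
√ d .located {q} q<r with q <? 0ℚ
... | yes q<0 = inj₁ (inj₁ q<0)
... | no  q≮0 with q * q <? d
...   | yes q²<d = inj₁ (inj₂ q²<d)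
...   | no  q²≮d = inj₂ (≤-<-trans (≮⇒≥ q≮0) q<r , ≤-<-trans (≮⇒≥ q²≮d) (square-mono-< (≮⇒≥ q≮0) q<r))

------------------------------------------------------------------------

-- The subtractions in ℕ do not truncate, since δ ≤ Δ and δ ≤ n; division of
-- naturals is the floor.
upperBound : (n m δ Δ : ℕ) → ℝ
upperBound n m δ Δ =
     fromℕ (Δ ℕ.∸ δ ℕ.+ 1)
  ⊓ᴿ fromℕ ((n ℕ.∸ δ ℕ.+ 1) ℕ./ 2)
  ⊓ᴿ ((1ℚ +ᴿ √ (ℤ→ℚ radicand)) /2)
  where
  radicand : ℤ
  radicand = + 2 ℤ.* + n ℤ.* + n ℤ.- + 2 ℤ.* + n ℤ.- + 4 ℤ.* + m ℤ.+ + 1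

{-# OPTIONS --safe #-}
-- Let A be irregular independent with k members, S its degree sum and b = n − k.
-- The degrees in A are k distinct numbers in [δ, Δ], and at most b because A is
-- independent; hence δ + k − 1 ≤ Δ, δ + k − 1 ≤ n − k and 2S ≤ 2kb − k(k − 1).
-- Every edge meets A or lies inside the complement, so 2m ≤ 2S + b(b − 1), and
-- together these give (2k − 1)² ≤ 2n² − 2n − 4m + 1. Both bounds equal 1 for K₁.

module Submission where

open import Defs
import Algebra.Properties.Semiring.Sum as Sum
open import Data.Bool.Base using (true; false; if_then_else_)
open import Data.Empty using (⊥)
open import Data.Fin.Base as Fin using (Fin; zero; suc)
import Data.Fin.Properties as Fin
open import Data.Fin.Subset using (Subset; inside; outside; _∈_; ∣_∣; ⁅_⁆; ∁)
open import Data.Fin.Subset.Properties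
  using (_∈?_; x∈⁅x⁆; x∈⁅y⁆⇒x≡y; ∣⁅x⁆∣≡1; p⊆q⇒∣p∣≤∣q∣; x∉p⇒x∈∁p; ∣∁p∣≡n∸∣p∣; ∣p∣≤n)
open import Data.Integer.Base as ℤ using (+_)
import Data.Integer.Properties as ℤ
open import Data.Integer.Tactic.RingSolver using () renaming (solve-∀ to ℤ-solve-∀)
open import Data.List.Base
  using (List; []; _∷_; _++_; map; filter; length; tabulate; allFin; cartesianProduct)
open import Data.List.Extrema.Nat using (min≤xs; xs≤max)
open import Data.List.Membership.Propositional.Properties using (∈-allFin; ∈-map⁺)
open import Data.List.Properties
  using (filter-++; length-++; length-map; map-tabulate)
open import Data.List.Relation.Binary.Permutation.Propositional using (↭-sym; ↭⇒↭ₛ)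
open import Data.List.Relation.Binary.Permutation.Propositional.Properties
  using (All-resp-↭; ↭-length)
open import Data.List.Relation.Binary.Permutation.Setoid.Properties using (Unique-resp-↭)
open import Data.List.Relation.Unary.All as All using (All; []; _∷_)
import Data.List.Relation.Unary.All.Properties as All
open import Data.List.Relation.Unary.AllPairs as AllPairs using (AllPairs; []; _∷_)
open import Data.List.Relation.Unary.Sorted.TotalOrder.Properties using (Sorted⇒AllPairs)
open import Data.List.Relation.Unary.Unique.Propositional using (Unique)
import Data.List.Relation.Unary.Unique.Propositional.Properties as Unique
open import Data.Nat.Base
open import Data.Nat.DivMod using (/-monoˡ-≤; m*n/n≡m)
open import Data.Nat.ListAction using (sum)
open import Data.Nat.ListAction.Properties using (sum-↭)
open import Data.Nat.Properties
open import Data.List.Sort ≤-decTotalOrder using (sort; sort-↭; sort-↗)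
open import Data.Nat.Tactic.RingSolver using (solve-∀)
open import Data.Product.Base using (_×_; ∃-syntax; _,_; proj₁; proj₂)
open import Data.Rational.Base as ℚ using (0ℚ; 1ℚ; toℚᵘ)
import Data.Rational.Properties as ℚ
open import Data.Rational.Unnormalised.Base as ℚᵘ using (mkℚᵘ; *≤*; *≡*)
import Data.Rational.Unnormalised.Properties as ℚᵘ
open import Data.Sum.Base using (inj₁; inj₂)
open import Data.Vec.Base using ([]; _∷_)
open import Data.Vec.Properties using (lookup⇒[]=; []=⇒lookup; lookup∘tabulate)
open import Function.Base using (_∘_; id)
open import Relation.Binary.Definitions using (tri<; tri≈; tri>)
open import Relation.Binary.PropositionalEquality
open import Relation.Nullary using (Dec; yes; no; ¬_; does; contradiction)
open import Relation.Nullary.Decidable using (dec-true; dec-false; _×-dec_)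
open import Relation.Unary using (Pred; Decidable)

open Sum +-*-semiring
  using (sum-syntax; sum-cong-≗; ∑-distrib-+; ∑-comm; *-distribˡ-sum; *-distribʳ-sum)

-- Sums and indicator functions

∑-mono : ∀ {n} {f g : Fin n → ℕ} → (∀ i → f i ≤ g i) → ∑[ i < n ] f i ≤ ∑[ i < n ] g i
∑-mono {zero}  f≤g = z≤n
∑-mono {suc n} f≤g = +-mono-≤ (f≤g zero) (∑-mono (f≤g ∘ suc))

𝟙 : ∀ {p} {P : Set p} → Dec P → ℕ
𝟙 P? = if does P? then 1 else 0

𝟙-yes : ∀ {p} {P : Set p} (P? : Dec P) → P → 𝟙 P? ≡ 1
𝟙-yes P? p = cong (λ b → if b then 1 else 0) (dec-true P? p)

𝟙-no : ∀ {p} {P : Set p} (P? : Dec P) → ¬ P → 𝟙 P? ≡ 0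
𝟙-no P? ¬p = cong (λ b → if b then 1 else 0) (dec-false P? ¬p)

𝟙-≤ : ∀ {p} {P : Set p} (P? : Dec P) {n} → (P → 1 ≤ n) → 𝟙 P? ≤ n
𝟙-≤ (yes p) 1≤n = 1≤n p
𝟙-≤ (no _)  _   = z≤n

∣p∣≡∑𝟙 : ∀ {n} (p : Subset n) → ∣ p ∣ ≡ ∑[ i < n ] 𝟙 (i ∈? p)
∣p∣≡∑𝟙 []            = refl
∣p∣≡∑𝟙 (inside  ∷ p) = cong suc (∣p∣≡∑𝟙 p)
∣p∣≡∑𝟙 (outside ∷ p) = ∣p∣≡∑𝟙 p

∑∑ : ∀ {n} → (Fin n → Fin n → ℕ) → ℕ
∑∑ {n} f = ∑[ i < n ] ∑[ j < n ] f i j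

∑∑-mono : ∀ {n} {f g : Fin n → Fin n → ℕ} → (∀ i j → f i j ≤ g i j) → ∑∑ f ≤ ∑∑ g
∑∑-mono f≤g = ∑-mono λ i → ∑-mono (f≤g i)

∑∑-distrib-+ : ∀ {n} (f g : Fin n → Fin n → ℕ) → ∑∑ (λ i j → f i j + g i j) ≡ ∑∑ f + ∑∑ g
∑∑-distrib-+ {n} f g = trans (sum-cong-≗ λ i → ∑-distrib-+ (f i) (g i))
                             (∑-distrib-+ (λ i → ∑[ j < n ] f i j) (λ i → ∑[ j < n ] g i j))

∑∑-distrib-+₃ : ∀ {n} (f g h : Fin n → Fin n → ℕ) →
  ∑∑ (λ i j → f i j + g i j + h i j) ≡ ∑∑ f + ∑∑ g + ∑∑ h
∑∑-distrib-+₃ f g h = trans (∑∑-distrib-+ (λ i j → f i j + g i j) h)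
                            (cong (_+ ∑∑ h) (∑∑-distrib-+ f g))

-- The counts `out`, `diag` and `both` below all have this form, with `p` the neighbourhoods, the
-- singletons and a constant set respectively.
∑∑-weighted-∈ : ∀ {n} (f : Fin n → ℕ) (p : Fin n → Subset n) →
  ∑∑ (λ i j → f i * 𝟙 (j ∈? p i)) ≡ ∑[ i < n ] (f i * ∣ p i ∣)
∑∑-weighted-∈ f p = sum-cong-≗ λ i →
  trans (sym (*-distribˡ-sum (f i) (λ j → 𝟙 (j ∈? p i)))) (cong (f i *_) (sym (∣p∣≡∑𝟙 (p i))))

∑𝟙*c≡∣p∣*c : ∀ {n} (p : Subset n) c → ∑[ i < n ] (𝟙 (i ∈? p) * c) ≡ ∣ p ∣ * c
∑𝟙*c≡∣p∣*c p c = trans (sym (*-distribʳ-sum c (λ i → 𝟙 (i ∈? p)))) (cong (_* c) (sym (∣p∣≡∑𝟙 p)))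

module _ {a p} {A : Set a} {P : Pred A p} (P? : Decidable P) where

  length-filter-tabulate : ∀ {n} (g : Fin n → A) →
    length (filter P? (tabulate g)) ≡ ∑[ i < n ] 𝟙 (P? (g i))
  length-filter-tabulate {zero}  g = refl
  length-filter-tabulate {suc n} g with does (P? (g zero))
  ... | true  = cong suc (length-filter-tabulate (g ∘ suc))
  ... | false = length-filter-tabulate (g ∘ suc)

  sum-filter-tabulate : ∀ {n} (f : A → ℕ) (g : Fin n → A) →
    sum (map f (filter P? (tabulate g))) ≡ ∑[ i < n ] (𝟙 (P? (g i)) * f (g i))
  sum-filter-tabulate {zero}  f g = refl
  sum-filter-tabulate {suc n} f g with does (P? (g zero))
  ... | true  = cong₂ _+_ (sym (+-identityʳ _)) (sum-filter-tabulate f (g ∘ suc))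
  ... | false = sum-filter-tabulate f (g ∘ suc)

-- Turns `size`, defined as the length of a filtered list, into a double sum over ordered pairs.
length-filter-cartesianProduct :
  ∀ {a b p} {A : Set a} {B : Set b} {P : Pred (A × B) p} (P? : Decidable P)
  {m n} (g : Fin m → A) (h : Fin n → B) →
  length (filter P? (cartesianProduct (tabulate g) (tabulate h))) ≡
  ∑[ i < m ] ∑[ j < n ] 𝟙 (P? (g i , h j))
length-filter-cartesianProduct P? {zero}  g h = refl
length-filter-cartesianProduct P? {suc m} {n} g h = begin
  length (filter P? (row ++ rest))
    ≡⟨ cong length (filter-++ P? row rest) ⟩
  length (filter P? row ++ filter P? rest)
    ≡⟨ length-++ (filter P? row) ⟩
  length (filter P? row) + length (filter P? rest)
    ≡⟨ cong₂ _+_ (trans (cong (length ∘ filter P?) (map-tabulate h (g zero ,_)))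
                        (length-filter-tabulate P? (λ j → g zero , h j)))
                 (length-filter-cartesianProduct P? (g ∘ suc) h) ⟩
  ∑[ i < suc m ] ∑[ j < n ] 𝟙 (P? (g i , h j)) ∎
  where
  open ≡-Reasoning
  row  = map (g zero ,_) (tabulate h)
  rest = cartesianProduct (tabulate (g ∘ suc)) (tabulate h)

-- Distinct natural numbers in an interval

-- Injectivity is asked for only under `P`, since `degree` is injective on an irregular set but not
-- on all vertices.
Unique-map⁺ : ∀ {a b p} {A : Set a} {B : Set b} {P : Pred A p} {f : A → B} →
  (∀ {x y} → P x → P y → x ≢ y → f x ≢ f y) →
  ∀ {xs} → All P xs → Unique xs → Unique (map f xs)
Unique-map⁺ inj []         []           = []
Unique-map⁺ inj (px ∷ pxs) (x∉xs ∷ xs!) =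
  All.map⁺ (All.zipWith (λ (py , x≢y) → inj px py x≢y) (pxs , x∉xs)) ∷ Unique-map⁺ inj pxs xs!

-- Successive terms grow by at least one, so the last is at least `x + length xs`.
ascending-length : ∀ {N x xs} → AllPairs _<_ (x ∷ xs) → All (_≤ N) (x ∷ xs) → x + length xs ≤ N
ascending-length {x = x} {[]}     _ (x≤N ∷ []) = subst (_≤ _) (sym (+-identityʳ x)) x≤N
ascending-length {x = x} {y ∷ ys} ((x<y ∷ _) ∷ asc) (_ ∷ ys≤N) = begin
  x + suc (length ys)  ≡⟨ +-suc x (length ys) ⟩
  suc x + length ys    ≤⟨ +-monoˡ-≤ (length ys) x<y ⟩
  y + length ys        ≤⟨ ascending-length asc ys≤N ⟩
  _ ∎
  where open ≤-Reasoning

-- Counting from 0 at the top, the i-th term is at most N - i, so k terms have sum at most kN - k(k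
-- - 1)/2; this is doubled and the subtraction cleared. Each induction step removes the least term,
-- which `ascending-length` bounds by N - (number of later terms).
ascending-sum : ∀ {N xs} → AllPairs _<_ xs → All (_≤ N) xs →
  sum xs + sum xs + length xs * length xs ≤ length xs * suc (N + N)
ascending-sum {xs = []} _ _ = z≤n
ascending-sum {N} {x ∷ xs} asc@(_ ∷ asc′) xs≤N@(_ ∷ xs≤N′) = begin
  (x + s) + (x + s) + suc k * suc k            ≡⟨ regroup x s k ⟩
  suc ((x + k) + (x + k)) + (s + s + k * k)    ≤⟨ +-mono-≤ (s≤s (+-mono-≤ x+k≤N x+k≤N)) (ascending-sum asc′ xs≤N′) ⟩
  suc (N + N) + k * suc (N + N)                ∎
  where
  open ≤-Reasoning
  s = sum xs
  k = length xs
  x+k≤N = ascending-length asc xs≤N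
  regroup : ∀ x s k → (x + s) + (x + s) + suc k * suc k ≡ suc ((x + k) + (x + k)) + (s + s + k * k)
  regroup = solve-∀

sort-ascending : ∀ {xs} → Unique xs → AllPairs _<_ (sort xs)
sort-ascending {xs} xs! = AllPairs.zipWith (λ (x≤y , x≢y) → ≤∧≢⇒< x≤y x≢y)
  ( Sorted⇒AllPairs ≤-totalOrder (sort-↗ xs)
  , Unique-resp-↭ (setoid ℕ) (↭⇒↭ₛ (↭-sym (sort-↭ xs))) xs!)

module _ {N xs} (xs! : Unique xs) (xs≤N : All (_≤ N) xs) where

  private
    sorted≤N = All-resp-↭ (↭-sym (sort-↭ xs)) xs≤N

  -- After sorting, the first term is at least `l` and `ascending-length` applies. Nonemptiness
  -- matters: an empty list says nothing about how `l` compares with `N`.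
  Unique-length : ∀ {l} → 1 ≤ length xs → All (l ≤_) xs → l + length xs ≤ suc N
  Unique-length {l} 1≤k l≤xs
    -- Lengths are moved to the sorted list, so that its empty case contradicts `1≤k`.
    rewrite sym (↭-length (sort-↭ xs))
    with sort xs | All-resp-↭ (↭-sym (sort-↭ xs)) l≤xs | sort-ascending xs! | sorted≤N
  ... | y ∷ ys | l≤y ∷ _ | asc | ≤N = begin
    l + suc (length ys)    ≡⟨ +-suc l (length ys) ⟩
    suc (l + length ys)    ≤⟨ s≤s (+-monoˡ-≤ (length ys) l≤y) ⟩
    suc (y + length ys)    ≤⟨ s≤s (ascending-length asc ≤N) ⟩
    suc N                  ∎
    where open ≤-Reasoning

  Unique-sum : sum xs + sum xs + length xs * length xs ≤ length xs * suc (N + N)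
  Unique-sum = subst₂ (λ s k → s + s + k * k ≤ k * suc (N + N))
    (sum-↭ (sort-↭ xs)) (↭-length (sort-↭ xs)) (ascending-sum (sort-ascending xs!) sorted≤N)

-- Degree sums, edge counts and irregular independent sets

module _ (G : Graph) where
  open Graph G

  ~⇒∈neighbours : ∀ {u v} → u ~ v → v ∈ neighbours G u
  ~⇒∈neighbours {u} {v} u~v =
    lookup⇒[]= v _ (trans (lookup∘tabulate _ v) (dec-true (u ~? v) u~v))

  ∈neighbours⇒~ : ∀ {u v} → v ∈ neighbours G u → u ~ v
  ∈neighbours⇒~ {u} {v} v∈ with u ~? v | trans (sym ([]=⇒lookup v∈)) (lookup∘tabulate (λ w → does (u ~? w)) v)
  ... | yes u~v | _ = u~v

  minDegree≤degree : ∀ u → minDegree G ≤ degree G u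
  minDegree≤degree u = All.lookup (min≤xs order _) (∈-map⁺ (degree G) (∈-allFin u))

  degree≤maxDegree : ∀ u → degree G u ≤ maxDegree G
  degree≤maxDegree u = All.lookup (xs≤max 0 _) (∈-map⁺ (degree G) (∈-allFin u))

  degreeSum : Subset order → ℕ
  degreeSum A = ∑[ u < order ] (𝟙 (u ∈? A) * degree G u)

  module _ (A : Subset order) where

    -- Both orientations of each edge are counted; `diag` accounts for the b pairs
    -- (u, u) with u ∉ A, which are counted in `both` but are not edges.
    private
      B = ∁ A
      edge? : ∀ u v → Dec (u Fin.< v × u ~ v)
      edge? u v = (u Fin.<? v) ×-dec (u ~? v)
      out : Vertex → Vertex → ℕ
      out u v = 𝟙 (u ∈? A) * 𝟙 (v ∈? neighbours G u)
      both : Vertex → Vertex → ℕ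
      both u v = 𝟙 (u ∈? B) * 𝟙 (v ∈? B)
      diag : Vertex → Vertex → ℕ
      diag u v = 𝟙 (u ∈? B) * 𝟙 (v ∈? ⁅ u ⁆)

      -- An edge meeting `A` is counted by `out` from an endpoint in `A`; otherwise both endpoints
      -- lie in the complement and `both` counts it.
      cover : ∀ {u v} → u ~ v → 1 ≤ out u v + out v u + both u v
      cover {u} {v} u~v with u ∈? A | v ∈? A
      ... | yes u∈A | _
        rewrite 𝟙-yes (v ∈? neighbours G u) (~⇒∈neighbours u~v) = s≤s z≤n
      ... | no _ | yes v∈A
        rewrite 𝟙-yes (u ∈? neighbours G v) (~⇒∈neighbours (~-sym u~v)) = s≤s z≤n
      ... | no u∉A | no v∉A
        rewrite 𝟙-yes (u ∈? B) (x∉p⇒x∈∁p u∉A) | 𝟙-yes (v ∈? B) (x∉p⇒x∈∁p v∉A) = s≤s z≤n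

      edge≤cover : ∀ u v → 𝟙 (edge? u v) ≤ out u v + out v u + both u v
      edge≤cover u v = 𝟙-≤ (edge? u v) (cover ∘ proj₂)

      cover-comm : ∀ u v → out u v + out v u + both u v ≡ out v u + out u v + both v u
      cover-comm u v = cong₂ _+_ (+-comm (out u v) (out v u)) (*-comm (𝟙 (u ∈? B)) (𝟙 (v ∈? B)))

      -- At most one term on the left is nonzero: an edge is listed with its smaller endpoint first,
      -- and `diag` lives on the diagonal.
      edges≤cover : ∀ u v →
        𝟙 (edge? u v) + 𝟙 (edge? v u) + diag u v ≤ out u v + out v u + both u v
      edges≤cover u v with Fin.<-cmp u v
      ... | tri< u<v u≢v v≮u
        rewrite 𝟙-no (edge? v u) (v≮u ∘ proj₁)
              | 𝟙-no (v ∈? ⁅ u ⁆) (u≢v ∘ sym ∘ x∈⁅y⁆⇒x≡y u)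
              | *-zeroʳ (𝟙 (u ∈? B))
              -- Twice, for the zeros left by the reversed pair and by `diag`.
              | +-identityʳ (𝟙 (edge? u v))
              | +-identityʳ (𝟙 (edge? u v)) = edge≤cover u v
      ... | tri> u≮v u≢v v<u
        rewrite 𝟙-no (edge? u v) (u≮v ∘ proj₁)
              | 𝟙-no (v ∈? ⁅ u ⁆) (u≢v ∘ sym ∘ x∈⁅y⁆⇒x≡y u)
              | *-zeroʳ (𝟙 (u ∈? B))
              | +-identityʳ (𝟙 (edge? v u)) = ≤-trans (edge≤cover v u) (≤-reflexive (cover-comm v u))
      ... | tri≈ u≮u refl _
        rewrite 𝟙-no (edge? u u) (u≮u ∘ proj₁) =
          ≤-trans (diag≤both (u ∈? B)) (m≤n+m (both u u) (out u u + out u u))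
        where
        -- The decision is abstracted so that one match settles all its occurrences.
        diag≤both : (d : Dec (u ∈ B)) → 𝟙 d * 𝟙 (u ∈? ⁅ u ⁆) ≤ 𝟙 d * 𝟙 d
        diag≤both (yes _) rewrite 𝟙-yes (u ∈? ⁅ u ⁆) (x∈⁅x⁆ u) = ≤-refl
        diag≤both (no _) = z≤n

    -- This is 2m ≤ 2S + b(b - 1) with b added to both sides, obtained by summing `edges≤cover` over
    -- all ordered pairs.
    size-bound : size G + size G + ∣ ∁ A ∣ ≤ degreeSum A + degreeSum A + ∣ ∁ A ∣ * ∣ ∁ A ∣
    size-bound = begin
      size G + size G + ∣ B ∣
        -- Exchanging the order of summation reduces the reversed pairs to the same edge count.
        ≡⟨ cong₂ _+_ (cong₂ _+_ size≡ (trans (∑-comm (λ u v → 𝟙 (edge? v u))) size≡)) diag≡ ⟨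
      ∑∑ (λ u v → 𝟙 (edge? u v)) + ∑∑ (λ u v → 𝟙 (edge? v u)) + ∑∑ diag
        ≡⟨ ∑∑-distrib-+₃ (λ u v → 𝟙 (edge? u v)) (λ u v → 𝟙 (edge? v u)) diag ⟨
      ∑∑ (λ u v → 𝟙 (edge? u v) + 𝟙 (edge? v u) + diag u v)
        ≤⟨ ∑∑-mono edges≤cover ⟩
      ∑∑ (λ u v → out u v + out v u + both u v)
        ≡⟨ ∑∑-distrib-+₃ out (λ u v → out v u) both ⟩
      ∑∑ out + ∑∑ (λ u v → out v u) + ∑∑ both
        ≡⟨ cong₂ _+_ (cong₂ _+_ out≡ (trans (∑-comm (λ u v → out v u)) out≡)) both≡ ⟩
      degreeSum A + degreeSum A + ∣ B ∣ * ∣ B ∣ ∎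
      where
      open ≤-Reasoning
      size≡ : ∑∑ (λ u v → 𝟙 (edge? u v)) ≡ size G
      size≡ = sym (length-filter-cartesianProduct (λ (u , v) → edge? u v) id id)
      diag≡ : ∑∑ diag ≡ ∣ B ∣
      diag≡ = trans (∑∑-weighted-∈ (λ u → 𝟙 (u ∈? B)) ⁅_⁆)
        (trans (sum-cong-≗ λ u → cong (𝟙 (u ∈? B) *_) (∣⁅x⁆∣≡1 u)) (trans (∑𝟙*c≡∣p∣*c B 1) (*-identityʳ _)))
      out≡ : ∑∑ out ≡ degreeSum A
      out≡ = ∑∑-weighted-∈ (λ u → 𝟙 (u ∈? A)) (neighbours G)
      both≡ : ∑∑ both ≡ ∣ B ∣ * ∣ B ∣
      both≡ = trans (∑∑-weighted-∈ (λ u → 𝟙 (u ∈? B)) (λ _ → B)) (∑𝟙*c≡∣p∣*c B ∣ B ∣)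

  -- Three bounds on the cardinality of an irregular independent set

  module _ {A : Subset order} (irr : IrregularIndependent G A) where

    private
      k = ∣ A ∣
      b = ∣ ∁ A ∣
      members : List Vertex
      members = filter (_∈? A) (allFin order)
      members∈A : All (_∈ A) members
      members∈A = All.all-filter (_∈? A) (allFin order)
      degrees : List ℕ
      degrees = map (degree G) members

      n≡k+b : order ≡ k + b
      n≡k+b = sym (trans (cong (λ l → k + l) (∣∁p∣≡n∸∣p∣ A)) (m+[n∸m]≡n (∣p∣≤n A)))

      length-degrees : length degrees ≡ k
      length-degrees = trans (length-map (degree G) members)
        (trans (length-filter-tabulate (_∈? A) id) (sym (∣p∣≡∑𝟙 A)))

      sum-degrees : sum degrees ≡ degreeSum A
      sum-degrees = sum-filter-tabulate (_∈? A) (degree G) id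

      degrees-unique : Unique degrees
      degrees-unique = Unique-map⁺ (λ u∈A v∈A → proj₂ irr _ u∈A _ v∈A)
        members∈A (Unique.filter⁺ (_∈? A) (Unique.allFin⁺ order))

      degree≤b : ∀ {u} → u ∈ A → degree G u ≤ b
      degree≤b u∈A = p⊆q⇒∣p∣≤∣q∣ λ {v} v∈N →
        x∉p⇒x∈∁p λ v∈A → proj₁ irr _ u∈A v v∈A (∈neighbours⇒~ v∈N)

      degrees≤b : All (_≤ b) degrees
      degrees≤b = All.map⁺ (All.map degree≤b members∈A)

      degrees≤Δ : All (_≤ maxDegree G) degrees
      degrees≤Δ = All.map⁺ (All.universal degree≤maxDegree members)

      δ≤degrees : All (minDegree G ≤_) degrees
      δ≤degrees = All.map⁺ (All.universal minDegree≤degree members)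

      -- `N` is left open: it becomes Δ for the first bound and b for the second.
      δ+k≤ : ∀ {N} → 1 ≤ k → All (_≤ N) degrees → minDegree G + k ≤ suc N
      δ+k≤ {N} 1≤k ≤N = subst (λ l → minDegree G + l ≤ suc N) length-degrees
        (Unique-length degrees-unique ≤N (subst (1 ≤_) (sym length-degrees) 1≤k) δ≤degrees)

    card≤Δ∸δ+1 : 1 ≤ k → k ≤ maxDegree G ∸ minDegree G + 1
    card≤Δ∸δ+1 1≤k = begin
      k              ≤⟨ m+n≤o⇒m≤o∸n k (≤-trans (≤-reflexive (+-comm k δ)) (δ+k≤ 1≤k degrees≤Δ)) ⟩
      -- The 1 is moved out of the truncated difference by way of `Δ ≤ δ + (Δ ∸ δ)`.
      suc Δ ∸ δ      ≤⟨ m≤n+o⇒m∸n≤o (suc Δ) δ (≤-trans (s≤s (m≤n+m∸n Δ δ)) (≤-reflexive shuffle)) ⟩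
      Δ ∸ δ + 1      ∎
      where
      open ≤-Reasoning
      δ = minDegree G
      Δ = maxDegree G
      shuffle : suc (δ + (Δ ∸ δ)) ≡ δ + (Δ ∸ δ + 1)
      shuffle = trans (+-comm 1 _) (+-assoc δ (Δ ∸ δ) 1)

    -- Degrees at most b = n - k give δ + k ≤ n - k + 1, that is 2k ≤ n - δ + 1. Halving is monotone
    -- and sends `k * 2` exactly to `k`, so the floor costs nothing.
    card≤[n∸δ+1]/2 : 1 ≤ k → k ≤ (order ∸ minDegree G + 1) / 2
    card≤[n∸δ+1]/2 1≤k = subst (_≤ (n ∸ δ + 1) / 2) (m*n/n≡m k 2) (/-monoˡ-≤ 2 (+-cancelˡ-≤ δ _ _ (begin
      δ + k * 2        ≡⟨ shuffle δ k ⟩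
      (δ + k) + k      ≤⟨ +-monoˡ-≤ k (δ+k≤ 1≤k degrees≤b) ⟩
      suc b + k        ≡⟨ cong suc (trans (+-comm b k) (sym n≡k+b)) ⟩
      suc n            ≤⟨ s≤s (m≤n+m∸n n δ) ⟩
      suc (δ + (n ∸ δ))  ≡⟨ trans (+-comm 1 _) (+-assoc δ (n ∸ δ) 1) ⟩
      δ + (n ∸ δ + 1)  ∎)))
      where
      open ≤-Reasoning
      n = order
      δ = minDegree G
      shuffle : ∀ δ k → δ + k * 2 ≡ (δ + k) + k
      shuffle = solve-∀

    degreeSum-bound : degreeSum A + degreeSum A + k * k ≤ k * suc (b + b)
    degreeSum-bound = subst₂ (λ s l → s + s + l * l ≤ l * suc (b + b)) sum-degrees length-degrees
      (Unique-sum degrees-unique degrees≤b)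

    -- (2k − 1)² ≤ 2n² − 2n − 4m + 1 with all subtractions cleared.
    card-size-bound : 4 * (k * k) + 2 * order + 4 * size G ≤ 2 * (order * order) + 4 * k
    card-size-bound = subst (λ n → 4 * (k * k) + 2 * n + 4 * m ≤ 2 * (n * n) + 4 * k) (sym n≡k+b)
      -- Adding 4S lets S be eliminated: twice `degreeSum-bound` consumes it on the left, and twice
      -- `size-bound` returns it on the right.
      (+-cancelˡ-≤ (S + S + (S + S)) _ _ (begin
        S + S + (S + S) + (4 * (k * k) + 2 * (k + b) + 4 * m)
          ≡⟨ lhs S k b m ⟩
        2 * (m + m + b) + 2 * (S + S + k * k) + (2 * (k * k) + 2 * k)
          ≤⟨ +-monoˡ-≤ (2 * (k * k) + 2 * k)
               (+-mono-≤ (*-monoʳ-≤ 2 (size-bound A)) (*-monoʳ-≤ 2 degreeSum-bound)) ⟩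
        2 * (S + S + b * b) + 2 * (k * suc (b + b)) + (2 * (k * k) + 2 * k)
          ≡⟨ rhs S k b ⟩
        S + S + (S + S) + (2 * ((k + b) * (k + b)) + 4 * k) ∎))
      where
      open ≤-Reasoning
      S = degreeSum A
      m = size G
      lhs : ∀ S k b m → S + S + (S + S) + (4 * (k * k) + 2 * (k + b) + 4 * m)
          ≡ 2 * (m + m + b) + 2 * (S + S + k * k) + (2 * (k * k) + 2 * k)
      lhs = solve-∀
      rhs : ∀ S k b → 2 * (S + S + b * b) + 2 * (k * suc (b + b)) + (2 * (k * k) + 2 * k)
          ≡ S + S + (S + S) + (2 * ((k + b) * (k + b)) + 4 * k)
      rhs = solve-∀

-- The embeddings ℤ → ℚ → ℝ

-- `mkℚᵘ z 0` is z over 1, its second argument being the denominator minus one. Passing to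
-- unnormalised fractions reduces the next facts to integer arithmetic on numerators.
toℚᵘ-ℤ→ℚ : ∀ z → toℚᵘ (ℤ→ℚ z) ℚᵘ.≃ mkℚᵘ z 0
toℚᵘ-ℤ→ℚ z = ℚ.toℚᵘ-fromℚᵘ (mkℚᵘ z 0)

ℤ→ℚ-mono-≤ : ∀ {i j} → i ℤ.≤ j → ℤ→ℚ i ℚ.≤ ℤ→ℚ j
ℤ→ℚ-mono-≤ {i} {j} i≤j = ℚ.toℚᵘ-cancel-≤
  (ℚᵘ.≤-respˡ-≃ (ℚᵘ.≃-sym (toℚᵘ-ℤ→ℚ i)) (ℚᵘ.≤-respʳ-≃ (ℚᵘ.≃-sym (toℚᵘ-ℤ→ℚ j))
    (*≤* (ℤ.*-monoʳ-≤-nonNeg (+ 1) i≤j))))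

ℤ→ℚ-homo-+ : ∀ i j → ℤ→ℚ (i ℤ.+ j) ≡ ℤ→ℚ i ℚ.+ ℤ→ℚ j
ℤ→ℚ-homo-+ i j = ℚ.toℚᵘ-injective (begin
  toℚᵘ (ℤ→ℚ (i ℤ.+ j))                ≈⟨ toℚᵘ-ℤ→ℚ (i ℤ.+ j) ⟩
  mkℚᵘ (i ℤ.+ j) 0                    ≈⟨ *≡* (numerators i j) ⟩
  mkℚᵘ i 0 ℚᵘ.+ mkℚᵘ j 0              ≈⟨ ℚᵘ.+-cong (toℚᵘ-ℤ→ℚ i) (toℚᵘ-ℤ→ℚ j) ⟨
  toℚᵘ (ℤ→ℚ i) ℚᵘ.+ toℚᵘ (ℤ→ℚ j)      ≈⟨ ℚ.toℚᵘ-homo-+ (ℤ→ℚ i) (ℤ→ℚ j) ⟨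
  toℚᵘ (ℤ→ℚ i ℚ.+ ℤ→ℚ j)              ∎)
  where
  open ℚᵘ.≃-Reasoning
  numerators : ∀ i j → (i ℤ.+ j) ℤ.* + 1 ≡ (i ℤ.* + 1 ℤ.+ j ℤ.* + 1) ℤ.* + 1
  numerators = ℤ-solve-∀

ℤ→ℚ-homo-* : ∀ i j → ℤ→ℚ (i ℤ.* j) ≡ ℤ→ℚ i ℚ.* ℤ→ℚ j
ℤ→ℚ-homo-* i j = ℚ.toℚᵘ-injective (begin
  toℚᵘ (ℤ→ℚ (i ℤ.* j))                ≈⟨ toℚᵘ-ℤ→ℚ (i ℤ.* j) ⟩
  mkℚᵘ i 0 ℚᵘ.* mkℚᵘ j 0              ≈⟨ ℚᵘ.*-cong (toℚᵘ-ℤ→ℚ i) (toℚᵘ-ℤ→ℚ j) ⟨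
  toℚᵘ (ℤ→ℚ i) ℚᵘ.* toℚᵘ (ℤ→ℚ j)      ≈⟨ ℚ.toℚᵘ-homo-* (ℤ→ℚ i) (ℤ→ℚ j) ⟨
  toℚᵘ (ℤ→ℚ i ℚ.* ℤ→ℚ j)              ∎)
  where open ℚᵘ.≃-Reasoning

fromℕ-mono-≤ : ∀ {m n} → m ≤ n → fromℕ m ≤ᴿ fromℕ n
fromℕ-mono-≤ m≤n q q<m = ℚ.<-≤-trans q<m (ℤ→ℚ-mono-≤ (ℤ.+≤+ m≤n))

-- From the quadratic inequality to the real square root

square-mono-< : ∀ {q r} → 0ℚ ℚ.≤ q → q ℚ.< r → q ℚ.* q ℚ.< r ℚ.* r
square-mono-< {q} {r} 0≤q q<r = ℚ.≤-<-trans
  (ℚ.*-monoˡ-≤-nonNeg q ⦃ ℚ.nonNegative 0≤q ⦄ (ℚ.<⇒≤ q<r))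
  (ℚ.*-monoˡ-<-pos r ⦃ ℚ.positive (ℚ.≤-<-trans 0≤q q<r) ⦄ q<r)

-- With s = 2q - 1, the lower cut on the right asks that s < 0 or s² < d. If q < k and s ≥ 0, then s
-- < 2k - 1, hence s² < (2k - 1)² ≤ d.
fromℕ≤[1+√]/2 : ∀ {k} d → (+ k ℤ.+ + k ℤ.- + 1) ℤ.* (+ k ℤ.+ + k ℤ.- + 1) ℤ.≤ d →
  fromℕ k ≤ᴿ (1ℚ +ᴿ √ (ℤ→ℚ d)) /2
fromℕ≤[1+√]/2 {k} d c²≤d q q<k with (q ℚ.+ q ℚ.- 1ℚ) ℚ.<? 0ℚ
... | yes s<0 = inj₁ s<0
... | no  s≮0 = inj₂ (ℚ.<-≤-trans (square-mono-< (ℚ.≮⇒≥ s≮0) s<c)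
                 (subst (ℚ._≤ ℤ→ℚ d) (ℤ→ℚ-homo-* c c) (ℤ→ℚ-mono-≤ c²≤d)))
  where
  c = + k ℤ.+ + k ℤ.- + 1
  s<c : q ℚ.+ q ℚ.- 1ℚ ℚ.< ℤ→ℚ c
  s<c = subst (q ℚ.+ q ℚ.- 1ℚ ℚ.<_)
    (sym (trans (ℤ→ℚ-homo-+ (+ k ℤ.+ + k) (ℤ.- + 1)) (cong (ℚ._- 1ℚ) (ℤ→ℚ-homo-+ (+ k) (+ k)))))
    (ℚ.+-monoˡ-< (ℚ.- 1ℚ) (ℚ.+-mono-< q<k q<k))

-- The two inequalities have the same difference of sides: the 1 of the radicand cancels the 1 in
-- (2k - 1)².
radicand-bound : ∀ k n m → 4 * (k * k) + 2 * n + 4 * m ≤ 2 * (n * n) + 4 * k →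
  (+ k ℤ.+ + k ℤ.- + 1) ℤ.* (+ k ℤ.+ + k ℤ.- + 1) ℤ.≤
  + 2 ℤ.* + n ℤ.* + n ℤ.- + 2 ℤ.* + n ℤ.- + 4 ℤ.* + m ℤ.+ + 1
radicand-bound k n m le = ℤ.0≤i-j⇒j≤i (subst (+ 0 ℤ.≤_) (begin
  + (2 * (n * n) + 4 * k) ℤ.- + (4 * (k * k) + 2 * n + 4 * m)
    -- `+_` commutes with addition by computation, but products need `pos-*`.
    ≡⟨ cong₂ ℤ._-_
         (cong₂ ℤ._+_ (pos-*₃ 2 n n) (ℤ.pos-* 4 k))
         (cong₂ ℤ._+_ (cong₂ ℤ._+_ (pos-*₃ 4 k k) (ℤ.pos-* 2 n)) (ℤ.pos-* 4 m)) ⟩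
  (+ 2 ℤ.* (+ n ℤ.* + n) ℤ.+ + 4 ℤ.* + k)
    ℤ.- (+ 4 ℤ.* (+ k ℤ.* + k) ℤ.+ + 2 ℤ.* + n ℤ.+ + 4 ℤ.* + m)
    ≡⟨ rearrange (+ k) (+ n) (+ m) ⟩
  (+ 2 ℤ.* + n ℤ.* + n ℤ.- + 2 ℤ.* + n ℤ.- + 4 ℤ.* + m ℤ.+ + 1)
    ℤ.- (+ k ℤ.+ + k ℤ.- + 1) ℤ.* (+ k ℤ.+ + k ℤ.- + 1) ∎)
  (ℤ.i≤j⇒0≤j-i (ℤ.+≤+ le)))
  where
  open ≡-Reasoning
  pos-*₃ : ∀ a b c → + (a * (b * c)) ≡ + a ℤ.* (+ b ℤ.* + c)
  pos-*₃ a b c = trans (ℤ.pos-* a (b * c)) (cong (+ a ℤ.*_) (ℤ.pos-* b c))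
  rearrange : ∀ k n m →
    (+ 2 ℤ.* (n ℤ.* n) ℤ.+ + 4 ℤ.* k) ℤ.- (+ 4 ℤ.* (k ℤ.* k) ℤ.+ + 2 ℤ.* n ℤ.+ + 4 ℤ.* m) ≡
    (+ 2 ℤ.* n ℤ.* n ℤ.- + 2 ℤ.* n ℤ.- + 4 ℤ.* m ℤ.+ + 1)
      ℤ.- (k ℤ.+ k ℤ.- + 1) ℤ.* (k ℤ.+ k ℤ.- + 1)
  rearrange = ℤ-solve-∀

-- Bounds on the irregular independence number and their sharpness

1≤α-ir : ∀ G → 1 ≤ α-ir G
1≤α-ir G = subst (_≤ α-ir G) (∣⁅x⁆∣≡1 v) (α-ir-upper G ⁅ v ⁆ (independent , irregular))
  where
  open Graph G
  v : Vertex
  -- Vertex 0 exists because the order is nonzero. Its singleton is independent since there are no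
  -- loops, and irregular vacuously.
  v = Fin.fromℕ< (>-nonZero⁻¹ order)
  same : ∀ {u w} → u ∈ ⁅ v ⁆ → w ∈ ⁅ v ⁆ → u ≡ w
  same u∈ w∈ = trans (x∈⁅y⁆⇒x≡y v u∈) (sym (x∈⁅y⁆⇒x≡y v w∈))
  independent : Independent G ⁅ v ⁆
  independent _ u∈ _ w∈ = ~-irrefl (same u∈ w∈)
  irregular : Irregular G ⁅ v ⁆
  irregular _ u∈ _ w∈ u≢w = contradiction (same u∈ w∈) u≢w

-- The lower cut of a minimum is an intersection, so the three bounds are checked separately at each
-- rational `q`.
IrregularIndependent-card≤upperBound : ∀ G {A} → IrregularIndependent G A → 1 ≤ ∣ A ∣ →
  fromℕ ∣ A ∣ ≤ᴿ upperBound (Graph.order G) (size G) (minDegree G) (maxDegree G)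
IrregularIndependent-card≤upperBound G {A} irr 1≤k q q<k =
  ( fromℕ-mono-≤ (card≤Δ∸δ+1 G irr 1≤k) q q<k
  , fromℕ-mono-≤ (card≤[n∸δ+1]/2 G irr 1≤k) q q<k )
  , fromℕ≤[1+√]/2 {∣ A ∣} _ (radicand-bound ∣ A ∣ (Graph.order G) (size G) (card-size-bound G irr)) q q<k

α-ir≤upperBound : ∀ G →
  fromℕ (α-ir G) ≤ᴿ upperBound (Graph.order G) (size G) (minDegree G) (maxDegree G)
α-ir≤upperBound G =
  let A , irr , k≡α = α-ir-attained G
  in  subst (λ k → fromℕ k ≤ᴿ upperBound (Graph.order G) (size G) (minDegree G) (maxDegree G)) k≡α
        -- A largest irregular independent set is nonempty by the lower bound.
        (IrregularIndependent-card≤upperBound G irr (subst (1 ≤_) (sym k≡α) (1≤α-ir G)))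

K₁ : Graph
K₁ = record
  { order    = 1
  ; _~_      = λ _ _ → ⊥
  ; _~?_     = λ _ _ → no id
  ; ~-sym    = id
  ; ~-irrefl = λ _ → id
  }

theorem2p1 : ((G : Graph) →
    let n = Graph.order G
        m = size G
        δ = minDegree G
        Δ = maxDegree G
    in (1 ≤ α-ir G) × (fromℕ (α-ir G) ≤ᴿ upperBound n m δ Δ))
    × (∃[ G ] α-ir G ≡ 1)
    × (∃[ G ] fromℕ (α-ir G) ≃ᴿ upperBound (Graph.order G) (size G) (minDegree G) (maxDegree G))
theorem2p1 =
    (λ G → 1≤α-ir G , α-ir≤upperBound G)
  , (K₁ , refl)
  -- Here `α-ir K₁` and Δ - δ + 1 both compute to 1, so the first component of the minimum already
  -- gives the reverse inequality.
  , (K₁ , α-ir≤upperBound K₁ , λ q bound → proj₁ (proj₁ bound))
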